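{- There exists a graph $G$ on $31$ vertices such that $\operatorname{ce}(G)>\operatorname{btt}(G)$. Moreover, $\rho=\sup_{G}\frac{\operatorname{ce}(G)}{\operatorname{btt}(G)}$ satisfies $\rho\ge\frac{10}{9}$.
   Context: All graphs are finite, undirected and simple. A cluster graph is a graph in which every connected component is a clique. $\operatorname{ce}(G)$ denotes the optimal value of Cluster Editing: the minimum number of vertex pairs (edges to delete and missing edges to add) whose modification turns $G$ into a cluster graph. A bad triangle of $G$ is the set of three vertex pairs spanned by three vertices inducing a path $P_3$ in $G$, i.e. the two edges together with the missing edge of an induced $P_3$. $\operatorname{btt}(G)$ denotes the optimal value of Bad Triangle Transversal: the minimum size of a set $S$ of edges and missing edges of $G$ such that every bad triangle intersects $S$. The supremum defining $\rho$ is over all graphs $G$ with $\operatorname{btt}(G)>0$. -}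

module Defs where

open import Data.Bool.Base using (Bool; true; false; _∧_; _xor_; not; T; if_then_else_)
open import Data.Bool.Properties using (∧-comm; ∧-idem; xor-same; T?)
open import Data.Fin.Base using (Fin; combine; remQuot)
open import Data.Fin.Properties using (_<?_; _≟_; all?; remQuot-combine)
open import Data.Fin.Subset using (Subset)
open import Data.Fin.Subset.Properties using (anySubset?)
open import Data.Integer.Base using (+_)
open import Data.Nat.Base using (ℕ; zero; suc; _*_; _≤_; _>_; z≤n; >-nonZero)
open import Data.Nat.Properties using (+-0-commutativeMonoid; _≤?_; ≤-reflexive; ≰⇒>; ≤-antisym)
open import Data.Product.Base using (Σ; ∃; _×_; _,_; proj₁; uncurry)
open import Data.Rational as ℚ using (ℚ)
open import Data.Sum.Base using (_⊎_; inj₁)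
open import Data.Unit.Base using (tt)
open import Data.Vec.Base using (lookup; tabulate)
open import Data.Vec.Properties using (lookup∘tabulate)
open import Function.Base using (_∘_)
open import Level using (0ℓ)
open import Relation.Binary.Construct.Closure.ReflexiveTransitive using (Star; ε; _◅_)
open import Relation.Binary.PropositionalEquality using (_≡_; _≢_; refl; sym; trans; cong; cong₂; subst)
open import Relation.Nullary using (¬_; Dec; yes; no; contradiction)
open import Relation.Nullary.Decidable using (does; ¬?; _×-dec_; _⊎-dec_; _→-dec_; map′)
open import Relation.Unary using (Pred; Decidable; _⊆_)

open import Algebra.Properties.CommutativeMonoid.Sum +-0-commutativeMonoid
  using (sum-syntax; sum-cong-≗)

-- A set of unordered pairs of distinct vertices, the vertices being Fin n.
-- It serves both as the edge set of a graph and as a set S of edges and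
-- missing edges of a graph.
record PairSet (n : ℕ) : Set where
  field
    mem    : Fin n → Fin n → Bool
    symm   : ∀ u v → mem u v ≡ mem v u
    irrefl : ∀ u → mem u u ≡ false

open PairSet public

Graph : ℕ → Set
Graph = PairSet

infix 4 _─_∈_

_─_∈_ : ∀ {n} → Fin n → Fin n → PairSet n → Set
u ─ v ∈ S = T (mem S u v)

-- Every unordered pair is counted once, at its ordering u < v.
size : ∀ {n} → PairSet n → ℕ
size {n} S = ∑[ u < n ] ∑[ v < n ] (if does (u <? v) ∧ mem S u v then 1 else 0)

-- Delete the edges in S and add the missing edges in S.
infixl 6 _△_

_△_ : ∀ {n} → Graph n → PairSet n → Graph n
(G △ S) .mem u v  = mem G u v xor mem S u v
(G △ S) .symm u v = cong₂ _xor_ (symm G u v) (symm S u v)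
(G △ S) .irrefl u = cong₂ _xor_ (irrefl G u) (irrefl S u)

Connected : ∀ {n} → Graph n → Fin n → Fin n → Set
Connected G = Star (λ u v → u ─ v ∈ G)

IsClusterGraph : ∀ {n} → Graph n → Set
IsClusterGraph G = ∀ u v → Connected G u v → u ≢ v → u ─ v ∈ G

-- u, v, w induce a path P₃ with middle vertex v.
InducedP₃ : ∀ {n} → Graph n → Fin n → Fin n → Fin n → Set
InducedP₃ G u v w = u ≢ w × u ─ v ∈ G × v ─ w ∈ G × ¬ (u ─ w ∈ G)

IsClusterEditing : ∀ {n} → Graph n → PairSet n → Set
IsClusterEditing G S = IsClusterGraph (G △ S)

IsBadTriangleTransversal : ∀ {n} → Graph n → PairSet n → Set
IsBadTriangleTransversal G S =
  ∀ u v w → InducedP₃ G u v w → u ─ v ∈ S ⊎ v ─ w ∈ S ⊎ u ─ w ∈ S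

IsMinimumSize : ∀ {n} → Pred (PairSet n) 0ℓ → ℕ → Set
IsMinimumSize P k = (∃ λ S → P S × size S ≡ k) × (∀ S → P S → k ≤ size S)

private
  infix 4 _≐_

  _≐_ : ∀ {n} → PairSet n → PairSet n → Set
  S ≐ S′ = ∀ u v → mem S u v ≡ mem S′ u v

  size-cong : ∀ {n} (S S′ : PairSet n) → S ≐ S′ → size S ≡ size S′
  size-cong _ _ eq = sum-cong-≗ λ u → sum-cong-≗ λ v →
    cong (λ b → if does (u <? v) ∧ b then 1 else 0) (eq u v)

  offDiag : ∀ {n} → Fin n → Fin n → Bool
  offDiag u v = not (does (u ≟ v))

  offDiag-sym : ∀ {n} (u v : Fin n) → offDiag u v ≡ offDiag v u
  offDiag-sym u v with u ≟ v | v ≟ u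
  ... | yes _  | yes _  = refl
  ... | no _   | no _   = refl
  ... | yes eq | no ¬eq = contradiction (sym eq) ¬eq
  ... | no ¬eq | yes eq = contradiction (sym eq) ¬eq

  offDiag-irrefl : ∀ {n} (u : Fin n) → offDiag u u ≡ false
  offDiag-irrefl u with u ≟ u
  ... | yes _  = refl
  ... | no ¬eq = contradiction refl ¬eq

  full : ∀ {n} → PairSet n
  full .mem    = offDiag
  full .symm   = offDiag-sym
  full .irrefl = offDiag-irrefl

  decode : ∀ {n} → Subset (n * n) → PairSet n
  decode p .mem u v = offDiag u v ∧ (lookup p (combine u v) ∧ lookup p (combine v u))
  decode p .symm u v = cong₂ _∧_ (offDiag-sym u v) (∧-comm (lookup p (combine u v)) _)
  decode p .irrefl u rewrite offDiag-irrefl u = refl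

  encode : ∀ {n} → PairSet n → Subset (n * n)
  encode {n} S = tabulate (uncurry (mem S) ∘ remQuot n)

  lookup-encode : ∀ {n} (S : PairSet n) u v → lookup (encode S) (combine u v) ≡ mem S u v
  lookup-encode {n} S u v =
    trans (lookup∘tabulate (uncurry (mem S) ∘ remQuot n) (combine u v))
          (cong (uncurry (mem S)) (remQuot-combine u v))

  decode-encode : ∀ {n} (S : PairSet n) → S ≐ decode (encode S)
  decode-encode S u v
    rewrite lookup-encode S u v | lookup-encode S v u | symm S v u | ∧-idem (mem S u v)
    with u ≟ v
  ... | yes refl = irrefl S u
  ... | no _     = refl

  Respects≐ : ∀ {n} → Pred (PairSet n) 0ℓ → Set
  Respects≐ P = ∀ S S′ → S ≐ S′ → P S → P S′

  anyPairSet? : ∀ {n} {P : Pred (PairSet n) 0ℓ} → Respects≐ P → Decidable P → Dec (∃ P)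
  anyPairSet? {P = P} resp P? = map′
    (λ (p , x) → decode p , x)
    (λ (S , x) → encode S , resp S _ (decode-encode S) x)
    (anySubset? (P? ∘ decode))

  minimumSize : ∀ {n} {P : Pred (PairSet n) 0ℓ} →
                Respects≐ P → Decidable P → ∃ P → ∃ (IsMinimumSize P)
  minimumSize {n} {P} resp P? (S₀ , x₀) = search (size S₀) S₀ x₀ (≤-reflexive refl)
    where
    smaller? : ∀ k → Dec (∃ λ S → P S × size S ≤ k)
    smaller? k = anyPairSet?
      (λ { S S′ eq (x , le) → resp S S′ eq x , subst (_≤ k) (size-cong S S′ eq) le })
      (λ S → P? S ×-dec size S ≤? k)

    search : ∀ k S → P S → size S ≤ k → ∃ (IsMinimumSize P)
    search zero    S x le = zero , (S , x , ≤-antisym le z≤n) , λ _ _ → z≤n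
    search (suc k) S x le with smaller? k
    ... | yes (S′ , x′ , le′) = search k S′ x′ le′
    ... | no none = suc k , (S , x , ≤-antisym le (lower S x)) , lower
      where
      lower : ∀ S → P S → suc k ≤ size S
      lower S x = ≰⇒> λ le → none (S , x , le)

  -- Only used to decide IsClusterGraph.
  P₃-Free : ∀ {n} → Graph n → Set
  P₃-Free G = ∀ u v w → u ─ v ∈ G → v ─ w ∈ G → u ≢ w → u ─ w ∈ G

  P₃-free⇒cluster : ∀ {n} (G : Graph n) → P₃-Free G → IsClusterGraph G
  P₃-free⇒cluster G free u v ε u≢v = contradiction refl u≢v
  P₃-free⇒cluster G free u v (_◅_ {j = w} e c) u≢v with w ≟ v
  ... | yes refl = e
  ... | no w≢v   = free u w v e (P₃-free⇒cluster G free w v c w≢v) u≢v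

  isClusterGraph? : ∀ {n} → Decidable (IsClusterGraph {n})
  isClusterGraph? G = map′ (P₃-free⇒cluster G)
    (λ cl u v w e f → cl u w (e ◅ f ◅ ε))
    (all? λ u → all? λ v → all? λ w →
      T? _ →-dec T? _ →-dec ¬? (u ≟ w) →-dec T? _)

  isClusterGraph-resp : ∀ {n} → Respects≐ (IsClusterGraph {n})
  isClusterGraph-resp G G′ eq cl u v c u≢v =
    subst T (eq u v) (cl u v (back c) u≢v)
    where
    back : ∀ {u v} → Connected G′ u v → Connected G u v
    back ε       = ε
    back (e ◅ c) = subst T (sym (eq _ _)) e ◅ back c

  deleteAll : ∀ {n} (G : Graph n) → IsClusterEditing G G
  deleteAll G u v ε u≢v = contradiction refl u≢v
  deleteAll G u v (_◅_ {j = w} e c) u≢v with () ← subst T (xor-same (mem G u w)) e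

  isBTT? : ∀ {n} (G : Graph n) → Decidable (IsBadTriangleTransversal G)
  isBTT? G S = all? λ u → all? λ v → all? λ w →
    (¬? (u ≟ w) ×-dec T? _ ×-dec T? _ ×-dec ¬? (T? _)) →-dec
    (T? _ ⊎-dec T? _ ⊎-dec T? _)

  isBTT-resp : ∀ {n} (G : Graph n) → Respects≐ (IsBadTriangleTransversal G)
  isBTT-resp G S S′ eq btt u v w p rewrite sym (eq u v) | sym (eq v w) | sym (eq u w) = btt u v w p

  takeAll : ∀ {n} (G : Graph n) → IsBadTriangleTransversal G full
  takeAll G u v w (_ , e , _) with u ≟ v
  ... | no _     = inj₁ tt
  ... | yes refl with () ← subst T (irrefl G u) e

opaque
  ceOptimum : ∀ {n} (G : Graph n) → ∃ (IsMinimumSize (IsClusterEditing G))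
  ceOptimum G = minimumSize
    (λ S S′ eq → isClusterGraph-resp (G △ S) (G △ S′) λ u v → cong (mem G u v xor_) (eq u v))
    (λ S → isClusterGraph? (G △ S))
    (G , deleteAll G)

  bttOptimum : ∀ {n} (G : Graph n) → ∃ (IsMinimumSize (IsBadTriangleTransversal G))
  bttOptimum G = minimumSize (isBTT-resp G) (isBTT? G) (full , takeAll G)

ce : ∀ {n} → Graph n → ℕ
ce G = proj₁ (ceOptimum G)

btt : ∀ {n} → Graph n → ℕ
btt G = proj₁ (bttOptimum G)

-- A real number x (or +∞) is represented by its open lower cut {q ∈ ℚ | q < x};
-- then x ≤ y is inclusion of cuts, and the cut of a supremum is the union of
-- the cuts of the members.
LowerReal : Set₁
LowerReal = Pred ℚ 0ℓ

fromℚ : ℚ → LowerReal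
fromℚ x q = q ℚ.< x

sup : {I : Set} → (I → ℚ) → LowerReal
sup {I} f q = Σ I λ i → q ℚ.< f i

infix 4 _≥ᴿ_

_≥ᴿ_ : LowerReal → LowerReal → Set
x ≥ᴿ y = y ⊆ x

GraphWithPositiveBtt : Set
GraphWithPositiveBtt = Σ ℕ λ n → Σ (Graph n) λ G → btt G > 0

ratio : GraphWithPositiveBtt → ℚ
ratio (_ , G , btt>0) = (+ ce G ℚ./ btt G) {{>-nonZero btt>0}}

ρ : LowerReal
ρ = sup ratio

{-# OPTIONS --safe #-}

module Submission where

-- G is a blow-up of a spider: a centre of 4 vertices and three legs, each with an
-- inner block of 4 and an outer block of 5 vertices. Blocks are cliques, outer i
-- is joined to inner i and the centre only, and any two of the other blocks are
-- joined. The 108 pairs inner i – inner j (i ≠ j) and centre – outer i meet every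
-- bad triangle.
-- For cluster editing, the cost between different blocks is affine in each
-- block, so each block may be collapsed onto one of its vertices, with the
-- weight of the block; the search over the partitions of the 7 weighted blocks
-- gives 120. So the ratio of this single graph is 120 / 108 = 10 / 9.

open import Defs
open import Data.Bool.Base using (Bool; true; false; _∧_; _xor_; not; T; if_then_else_)
open import Data.Bool.Properties using (T?)
open import Data.Fin.Base as Fin using (Fin; zero; suc)
open import Data.Fin using (#_)
open import Data.Fin.Properties using (_≟_; _<?_; <-cmp)
open import Data.Integer.Base as ℤ using (+_)
import Data.Integer.Properties as ℤ
open import Data.List.Base
  using (List; []; _∷_; map; concat; allFin; filter; length; _++_)
open import Data.List.Extrema.Nat using (argmin; argmin-sel; f[argmin]≤f[⊤]; f[argmin]≤f[xs])
open import Data.List.Membership.Propositional using (_∈_; find; lose)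
open import Data.List.Properties using (map-++; map-cong)
open import Data.List.Relation.Unary.All as All using (All; []; _∷_)
open import Data.List.Relation.Unary.All.Properties using (all-filter)
open import Data.List.Relation.Unary.Any using (here; there; any?)
open import Data.Nat.Base
  using (ℕ; zero; suc; _+_; _*_; _⊓_; _≤_; _<_; _>_; z≤n; s≤s; z<s; NonZero; >-nonZero)
open import Data.Nat.ListAction using (sum)
open import Data.Nat.ListAction.Properties using (sum-++)
open import Data.Nat.Properties as ℕ using (≤-refl; ≤-trans; ≤-reflexive; module ≤-Reasoning)
open import Data.Nat.Solver using (module +-*-Solver)
open import Data.Product.Base using (∃; _×_; _,_; proj₂; map₁)
open import Data.Rational as ℚ using (_/_)
import Data.Rational.Properties as ℚ
import Data.Rational.Unnormalised.Base as ℚᵘ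
import Data.Rational.Unnormalised.Properties as ℚᵘ
open import Data.Sum.Base using (_⊎_; inj₁; inj₂)
open import Data.Sum.Properties using (≡-dec)
open import Data.Unit.Base using (⊤; tt)
open import Data.Unit.Properties using () renaming (_≟_ to _≟⊤_)
import Data.Vec.Base as Vec
open import Function.Base using (_∘_; const)
open import Function.Bundles using (mk⇔)
open import Level using (0ℓ)
open import Relation.Binary.Construct.Closure.ReflexiveTransitive using (ε; _◅_)
open import Relation.Binary.Core using (Rel)
open import Relation.Binary.Definitions using (DecidableEquality; tri<; tri≈; tri>)
open import Relation.Binary.PropositionalEquality
open import Relation.Binary.Structures using (IsDecEquivalence)
open import Relation.Nullary using (¬_; yes; no; contradiction)
open import Relation.Nullary.Decidable using (does; does-⇔; dec-true; dec-false; _⊎-dec_)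

open import Algebra.Properties.CommutativeMonoid.Sum ℕ.+-0-commutativeMonoid
  using (sum-syntax)

-- Sums over pairs, averages and bounded minima

indicator : Bool → ℕ
indicator b = if b then 1 else 0

module PairSums {V : Set} (d : V → V → ℕ) where

  pairSum : List V → ℕ
  pairSum []       = 0
  pairSum (u ∷ vs) = sum (map (d u) vs) + pairSum vs

  crossSum : List (List V) → ℕ
  crossSum []       = 0
  crossSum (B ∷ Bs) = sum (map (λ u → sum (map (d u) (concat Bs))) B) + crossSum Bs

  -- Pairs inside one block are missing on the left and cost at least 0 on the right.
  crossSum≤pairSum : ∀ Bs → crossSum Bs ≤ pairSum (concat Bs)
  crossSum≤pairSum []       = z≤n
  crossSum≤pairSum (B ∷ Bs) =
    ≤-trans (ℕ.+-monoʳ-≤ _ (crossSum≤pairSum Bs)) (prepend B)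
    where
    prepend : ∀ B → sum (map (λ u → sum (map (d u) (concat Bs))) B) + pairSum (concat Bs)
                      ≤ pairSum (B ++ concat Bs)
    prepend []      = ≤-refl
    prepend (u ∷ B) = begin
      sum (map (d u) R) + rest + pairSum R    ≡⟨ ℕ.+-assoc (sum (map (d u) R)) rest _ ⟩
      sum (map (d u) R) + (rest + pairSum R)  ≤⟨ ℕ.+-mono-≤ extend (prepend B) ⟩
      sum (map (d u) (B ++ R)) + pairSum (B ++ R) ∎
      where
      open ≤-Reasoning
      R = concat Bs
      rest = sum (map (λ u → sum (map (d u) R)) B)
      extend : sum (map (d u) R) ≤ sum (map (d u) (B ++ R))
      extend rewrite map-++ (d u) B R | sum-++ (map (d u) B) (map (d u) R) = ℕ.m≤n+m _ _

open PairSums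

module _ {V : Set} where

  sum-map-+ : ∀ (f g : V → ℕ) xs →
              sum (map (λ x → f x + g x) xs) ≡ sum (map f xs) + sum (map g xs)
  sum-map-+ f g []       = refl
  sum-map-+ f g (x ∷ xs) rewrite sum-map-+ f g xs =
    solve 4 (λ a b s t → (a :+ b) :+ (s :+ t) := (a :+ s) :+ (b :+ t)) refl
      (f x) (g x) (sum (map f xs)) (sum (map g xs))
    where open +-*-Solver

  sum-map-* : ∀ n (f : V → ℕ) xs → sum (map (λ x → n * f x) xs) ≡ n * sum (map f xs)
  sum-map-* n f []       = sym (ℕ.*-zeroʳ n)
  sum-map-* n f (x ∷ xs) rewrite sum-map-* n f xs = sym (ℕ.*-distribˡ-+ n (f x) _)

  length*k≤sum : ∀ {k} (f : V → ℕ) {xs} → All (λ x → k ≤ f x) xs →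
                 length xs * k ≤ sum (map f xs)
  length*k≤sum f []       = z≤n
  length*k≤sum f (p ∷ ps) = ℕ.+-mono-≤ p (length*k≤sum f ps)

  ∃≤average : ∀ (f : V → ℕ) xs → 0 < length xs →
              ∃ λ x → x ∈ xs × length xs * f x ≤ sum (map f xs)
  ∃≤average f (x ∷ xs) _ =
    argmin f x xs , member , length*k≤sum f (f[argmin]≤f[⊤] {f = f} x xs ∷ f[argmin]≤f[xs] {f = f} x xs)
    where
    member : argmin f x xs ∈ x ∷ xs
    member with argmin-sel f x xs
    ... | inj₁ eq  = here eq
    ... | inj₂ mem = there mem

-- The bound is inclusive: `k` itself competes, as the label of a newly opened class.
minimumUpTo : ℕ → (ℕ → ℕ) → ℕ
minimumUpTo zero    f = f zero
minimumUpTo (suc k) f = f (suc k) ⊓ minimumUpTo k f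

minimumUpTo-≤ : ∀ {k l} f → l ≤ k → minimumUpTo k f ≤ f l
minimumUpTo-≤ {zero}  f z≤n = ≤-refl
minimumUpTo-≤ {suc k} f l≤k with ℕ.m≤n⇒m<n∨m≡n l≤k
... | inj₁ (s≤s l≤k) = ≤-trans (ℕ.m⊓n≤n (f (suc k)) _) (minimumUpTo-≤ f l≤k)
... | inj₂ refl      = ℕ.m⊓n≤m (f (suc k)) _

-- Reduction of cluster editing on a blow-up to weighted blocks

module Template {K : Set} (adj : K → K → Bool) (weight : K → ℕ) where

  -- Counted from a single vertex of block `y`; `minCost` supplies the factor `weight y`.
  editCost : K → ℕ → List (K × ℕ) → ℕ
  editCost y l = sum ∘ map λ (x , k) → weight x * indicator (adj x y xor does (k ℕ.≟ l))

  -- A restricted growth string enumerates the partitions: the k classes used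
  -- so far are labelled 0, …, k - 1, and the next vertex joins one of them or
  -- opens class k.
  minCost : ℕ → List (K × ℕ) → List K → ℕ
  minCost k done []       = 0
  minCost k done (y ∷ ys) = minimumUpTo k λ l →
    weight y * editCost y l done + minCost (suc k) ((y , l) ∷ done) ys

  module BlowUp {V : Set} (block : V → K) (members : K → List V)
    (block-members  : ∀ y → All (λ v → block v ≡ y) (members y))
    (length-members : ∀ y → length (members y) ≡ weight y)
    (weight>0       : ∀ y → 0 < weight y)
    {_~_ : Rel V 0ℓ} (~-isDecEquivalence : IsDecEquivalence _~_)
    where

    open IsDecEquivalence ~-isDecEquivalence
      using () renaming (_≟_ to _~?_; refl to ~-refl; sym to ~-sym; trans to ~-trans)

    -- With `_~_` as "same cluster after editing", distinct vertices form a modified pair exactly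
    -- when their adjacency disagrees with `_~_`.
    edit : V → V → ℕ
    edit u v = indicator (adj (block u) (block v) xor does (u ~? v))

    collapsed : List (V × ℕ) → V → ℕ
    collapsed done v = sum (map (λ (w , _) → weight (block w) * edit w v) done)

    Consistent : List (V × ℕ) → Set
    Consistent done = ∀ {w k w′ k′} → (w , k) ∈ done → (w′ , k′) ∈ done →
                      does (w ~? w′) ≡ does (k ℕ.≟ k′)

    Labels : V → ℕ → List (V × ℕ) → Set
    Labels u l = All λ (w , k) → does (w ~? u) ≡ does (k ℕ.≟ l)

    Below : ℕ → List (V × ℕ) → Set
    Below k = All λ (_ , l) → l < k

    -- A vertex equivalent to an earlier representative inherits its label, which `Consistent` makes
    -- compatible with all others; any other vertex takes the fresh label `k`.
    label : ∀ {k done} u → Consistent done → Below k done → ∃ λ l → l ≤ k × Labels u l done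
    label {k} {done} u consistent below with any? (λ (w , _) → w ~? u) done
    ... | yes p with (w , l) , wl∈ , w~u ← find p =
      l , ℕ.<⇒≤ (All.lookup below wl∈) , All.tabulate λ {(v , _)} v∈ →
        trans (does-⇔ (mk⇔ (λ v~u → ~-trans v~u (~-sym w~u)) (λ v~w → ~-trans v~w w~u))
                      (v ~? u) (v ~? w))
              (consistent v∈ wl∈)
    ... | no ¬p = k , ≤-refl , All.tabulate λ {(v , l)} v∈ →
        trans (dec-false (v ~? u) (λ v~u → ¬p (lose v∈ v~u)))
              (sym (dec-false (l ℕ.≟ k) (ℕ.<⇒≢ (All.lookup below v∈))))

    extend : ∀ {u l done} → Labels u l done → Consistent done → Consistent ((u , l) ∷ done)
    extend {u} {l} lab consistent (here refl) (here refl) =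
      trans (dec-true (u ~? u) ~-refl) (sym (dec-true (l ℕ.≟ l) refl))
    extend {u} {l} lab consistent (here refl) (there {w , k} q) =
      trans (does-⇔ (mk⇔ ~-sym ~-sym) (u ~? _) (_ ~? u))
        (trans (All.lookup lab q) (does-⇔ (mk⇔ sym sym) (_ ℕ.≟ l) (l ℕ.≟ _)))
    extend lab consistent (there p) (here refl) = All.lookup lab p
    extend lab consistent (there p) (there q)   = consistent p q

    editCost≡collapsed : ∀ {u l done} → Labels u l done →
      editCost (block u) l (map (map₁ block) done) ≡ collapsed done u
    editCost≡collapsed []         = refl
    editCost≡collapsed (eq ∷ lab) =
      cong₂ _+_ (cong (λ b → weight _ * indicator (adj _ _ xor b)) (sym eq)) (editCost≡collapsed lab)

    -- The cost is affine in each block once the other blocks are fixed, so a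
    -- block may be collapsed onto its cheapest vertex, with its full weight.
    minCost≤ : ∀ k done ys → Consistent done → Below k done →
      minCost k (map (map₁ block) done) ys
        ≤ sum (map (collapsed done) (concat (map members ys))) + crossSum edit (map members ys)
    minCost≤ k done []       consistent below = z≤n
    minCost≤ k done (y ∷ ys) consistent below
      -- The averaged quantity is the cost of a vertex against the representatives in `done` plus
      -- its cost against the blocks not yet collapsed.
      with ∃≤average (λ u → collapsed done u + sum (map (edit u) (concat (map members ys))))
                     (members y) (subst (0 <_) (sym (length-members y)) (weight>0 y))
    ... | u , u∈ , average with refl ← All.lookup (block-members y) u∈
      with l , l≤k , lab ← label u consistent below = begin
      minCost k (map (map₁ block) done) (y ∷ ys)
        ≤⟨ minimumUpTo-≤ _ l≤k ⟩
      weight y * editCost y l (map (map₁ block) done) + minCost (suc k) (map (map₁ block) done′) ys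
        ≤⟨ ℕ.+-mono-≤ (≤-reflexive (cong (weight y *_) (editCost≡collapsed lab)))
                      (minCost≤ (suc k) done′ ys (extend lab consistent)
                        (s≤s l≤k ∷ All.map ℕ.m<n⇒m<1+n below)) ⟩
      -- As a new representative, `u` adds `weight y * edit u v` to the cost of each remaining `v`;
      -- collecting these terms gives `weight y` times the averaged quantity at `u`.
      weight y * g u + (sum (map (λ v → weight y * edit u v + g v) R) + X)
        ≡⟨ cong (λ s → weight y * g u + (s + X)) split ⟩
      weight y * g u + (weight y * E + sum (map g R) + X)
        ≡⟨ solve 5 (λ n a e s x → n :* a :+ (n :* e :+ s :+ x) := n :* (a :+ e) :+ (s :+ x))
             refl (weight y) (g u) E (sum (map g R)) X ⟩
      weight y * (g u + E) + (sum (map g R) + X)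
        ≤⟨ ℕ.+-monoˡ-≤ _ (subst (λ n → n * (g u + E) ≤ total) (length-members y) average) ⟩
      total + (sum (map g R) + X)
        ≡⟨ cong (_+ (sum (map g R) + X)) (sum-map-+ g _ B) ⟩
      sum (map g B) + sum (map (λ u → sum (map (edit u) R)) B) + (sum (map g R) + X)
        ≡⟨ solve 4 (λ a b c x → a :+ b :+ (c :+ x) := a :+ c :+ (b :+ x)) refl
             (sum (map g B)) _ (sum (map g R)) X ⟩
      sum (map g B) + sum (map g R) + crossSum edit (map members (y ∷ ys))
        ≡⟨ cong (_+ crossSum edit (map members (y ∷ ys)))
             (sym (trans (cong sum (map-++ g B R)) (sum-++ (map g B) (map g R)))) ⟩
      sum (map g (B ++ R)) + crossSum edit (map members (y ∷ ys)) ∎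
      where
      open ≤-Reasoning
      open +-*-Solver
      done′ = (u , l) ∷ done
      g = collapsed done
      B = members y
      R = concat (map members ys)
      X = crossSum edit (map members ys)
      E = sum (map (edit u) R)
      total = sum (map (λ u → g u + sum (map (edit u) R)) B)
      split : sum (map (λ v → weight y * edit u v + g v) R) ≡ weight y * E + sum (map g R)
      split = trans (sum-map-+ _ g R) (cong (_+ sum (map g R)) (sum-map-* (weight y) (edit u) R))

    minCost≤pairSum : ∀ ys → minCost 0 [] ys ≤ pairSum edit (concat (map members ys))
    minCost≤pairSum ys = begin
      minCost 0 [] ys
        ≤⟨ minCost≤ 0 [] ys (λ ()) [] ⟩
      sum (map (const 0) (concat (map members ys))) + crossSum edit (map members ys)
        ≡⟨ cong (_+ crossSum edit (map members ys)) (sum-map-* 0 (const 0) (concat (map members ys))) ⟩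
      crossSum edit (map members ys)
        ≤⟨ crossSum≤pairSum edit (map members ys) ⟩
      pairSum edit (concat (map members ys)) ∎
      where open ≤-Reasoning

-- The spider, its blow-up and the transversal

Block : Set
Block = ⊤ ⊎ Fin 3 ⊎ Fin 3

pattern centre  = inj₁ tt
pattern inner i = inj₂ (inj₁ i)
pattern outer i = inj₂ (inj₂ i)

_≟ᴮ_ : DecidableEquality Block
_≟ᴮ_ = ≡-dec _≟⊤_ (≡-dec _≟_ _≟_)

adj : Block → Block → Bool
adj (outer i) (outer j) = does (i ≟ j)
adj (outer i) (inner j) = does (i ≟ j)
adj (inner i) (outer j) = does (j ≟ i)
adj _         _         = true

soft : Block → Block → Bool
soft (inner i) (inner j) = not (does (i ≟ j))
soft centre    (outer _) = true
soft (outer _) centre    = true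
soft _         _         = false

does-≟-sym : ∀ {n} (i j : Fin n) → does (i ≟ j) ≡ does (j ≟ i)
does-≟-sym i j = does-⇔ (mk⇔ sym sym) (i ≟ j) (j ≟ i)

does-≟-refl : ∀ {n} (i : Fin n) → does (i ≟ i) ≡ true
does-≟-refl i = dec-true (i ≟ i) refl

adj-sym : ∀ x y → adj x y ≡ adj y x
adj-sym (outer i) (outer j) = does-≟-sym i j
adj-sym (outer i) (inner j) = refl
adj-sym (outer i) centre    = refl
adj-sym (inner i) (outer j) = refl
adj-sym (inner i) (inner j) = refl
adj-sym (inner i) centre    = refl
adj-sym centre    (outer j) = refl
adj-sym centre    (inner j) = refl
adj-sym centre    centre    = refl

adj-refl : ∀ x → adj x x ≡ true
adj-refl centre    = refl
adj-refl (inner i) = refl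
adj-refl (outer i) = does-≟-refl i

soft-sym : ∀ x y → soft x y ≡ soft y x
soft-sym (outer i) (outer j) = refl
soft-sym (outer i) (inner j) = refl
soft-sym (outer i) centre    = refl
soft-sym (inner i) (outer j) = refl
soft-sym (inner i) (inner j) = cong not (does-≟-sym i j)
soft-sym (inner i) centre    = refl
soft-sym centre    (outer j) = refl
soft-sym centre    (inner j) = refl
soft-sym centre    centre    = refl

soft-irrefl : ∀ x → soft x x ≡ false
soft-irrefl centre    = refl
soft-irrefl (inner i) = cong not (does-≟-refl i)
soft-irrefl (outer i) = refl

-- Non-adjacent blocks lie in different legs and at least one is outer. A path between them passes
-- through the centre, using a centre-outer pair, or has the form outer i - inner i - inner j, up to
-- reversal, using an inner-inner pair.
soft-transversal : ∀ x y z → T (adj x y) → T (adj y z) → ¬ T (adj x z) →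
                   T (soft x y) ⊎ T (soft y z)
soft-transversal centre    _         _         _ _ ¬g = contradiction _ ¬g
soft-transversal (inner _) _         centre    _ _ ¬g = contradiction _ ¬g
soft-transversal (inner _) _         (inner _) _ _ ¬g = contradiction _ ¬g
soft-transversal (outer _) _         centre    _ _ ¬g = contradiction _ ¬g
soft-transversal (outer _) centre    (inner _) _ _ _  = inj₁ _
soft-transversal (outer _) centre    (outer _) _ _ _  = inj₁ _
soft-transversal (inner _) centre    (outer _) _ _ _  = inj₂ _
soft-transversal (outer i) (outer j) (inner k) e f ¬g with yes refl ← i ≟ j = contradiction f ¬g
soft-transversal (outer i) (outer j) (outer k) e f ¬g with yes refl ← i ≟ j = contradiction f ¬g
soft-transversal (outer i) (inner j) (inner k) e f ¬g with yes refl ← i ≟ j | i ≟ k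
... | yes refl = contradiction _ ¬g
... | no _     = inj₂ _
soft-transversal (outer i) (inner j) (outer k) e f ¬g with yes refl ← i ≟ j | yes refl ← k ≟ j =
  contradiction (subst T (sym (does-≟-refl i)) _) ¬g
soft-transversal (inner i) (inner j) (outer k) e f ¬g with yes refl ← k ≟ j | i ≟ k
... | yes refl = contradiction (subst T (sym (does-≟-refl i)) _) ¬g
... | no _     = inj₁ _
soft-transversal (inner i) (outer j) (outer k) e f ¬g with yes refl ← j ≟ i | yes refl ← j ≟ k =
  contradiction (subst T (sym (does-≟-refl i)) _) ¬g

weight : Block → ℕ
weight centre    = 4
weight (inner _) = 4
weight (outer _) = 5

blocks : List Block
blocks = centre ∷ map inner (allFin 3) ++ map outer (allFin 3)

open Template adj weight

-- By evaluating the search over 7! = 5040 labellings, the block at position `k` (from 0) having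
-- `k + 1` choices.
minCost-blocks : minCost 0 [] blocks ≡ 120
minCost-blocks = refl

block : Fin 31 → Block
block = Vec.lookup (Vec.replicate 4 centre Vec.++ copies 4 inner Vec.++ copies 5 outer)
  where
  copies : ∀ m → (Fin 3 → Block) → Vec.Vec Block (3 * m)
  copies m f = Vec.concat (Vec.map (Vec.replicate m ∘ f) (Vec.allFin 3))

members : Block → List (Fin 31)
members y = filter (λ v → block v ≟ᴮ y) (allFin 31)

-- `block` numbers the vertices in the order of `blocks`, so listing them block by block is the
-- increasing order.
concat-members : concat (map members blocks) ≡ allFin 31
concat-members = refl

length-members : ∀ y → length (members y) ≡ weight y
length-members centre                   = refl
length-members (inner zero)             = refl
length-members (inner (suc zero))       = refl
length-members (inner (suc (suc zero))) = refl
length-members (outer zero)             = refl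
length-members (outer (suc zero))       = refl
length-members (outer (suc (suc zero))) = refl

weight>0 : ∀ y → 0 < weight y
weight>0 centre    = z<s
weight>0 (inner _) = z<s
weight>0 (outer _) = z<s

G : Graph 31
G .mem u v  = not (does (u ≟ v)) ∧ adj (block u) (block v)
G .symm u v = cong₂ _∧_ (cong not (does-≟-sym u v)) (adj-sym (block u) (block v))
G .irrefl u rewrite does-≟-refl u = refl

softPairs : PairSet 31
softPairs .mem u v  = soft (block u) (block v)
softPairs .symm u v = soft-sym (block u) (block v)
softPairs .irrefl u = soft-irrefl (block u)

-- 3 · 4 · 4 inner-inner pairs and 3 · 4 · 5 centre-outer pairs.
size-softPairs : size softPairs ≡ 108
size-softPairs = refl

-- For the concrete 31 vertices every test `u <? v` evaluates, and the terms failing it vanish.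
size≡pairSum : ∀ (S : PairSet 31) → size S ≡ pairSum (λ u v → indicator (mem S u v)) (allFin 31)
size≡pairSum S = refl

-- Lower bound for cluster editing

module _ {n : ℕ} {H : Graph n} (cluster : IsClusterGraph H) where

  -- In a cluster graph this is connectedness, put in a decidable form.
  SameCluster : Rel (Fin n) 0ℓ
  SameCluster u v = u ≡ v ⊎ u ─ v ∈ H

  sameCluster-isDecEquivalence : IsDecEquivalence SameCluster
  sameCluster-isDecEquivalence = record
    { isEquivalence = record
      { refl  = inj₁ refl
      ; sym   = λ where
          (inj₁ refl) → inj₁ refl
          (inj₂ e)    → inj₂ (subst T (symm H _ _) e)
      ; trans = λ where
          (inj₁ refl) p           → p
          p           (inj₁ refl) → p
          (inj₂ e)    (inj₂ f)    → join e f
      }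
    ; _≟_ = λ u v → (u ≟ v) ⊎-dec T? (mem H u v)
    }
    where
    join : ∀ {u v w} → u ─ v ∈ H → v ─ w ∈ H → SameCluster u w
    join {u} {v} {w} e f with u ≟ w
    ... | yes u≡w = inj₁ u≡w
    ... | no u≢w  = inj₂ (cluster u w (e ◅ f ◅ ε) u≢w)

module _ (S : PairSet 31) (editing : IsClusterEditing G S) where

  open BlowUp block members (λ y → all-filter (λ v → block v ≟ᴮ y) (allFin 31))
    length-members weight>0 (sameCluster-isDecEquivalence {H = G △ S} editing)

  -- Off the diagonal, xor with `adj` undoes the xor defining `G △ S`; on it, both sides are 0 since
  -- `adj` is reflexive.
  mem≡edit : ∀ u v → indicator (mem S u v) ≡ edit u v
  mem≡edit u v with u ≟ v
  ... | yes refl rewrite irrefl S u | adj-refl (block u) = refl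
  ... | no _ with adj (block u) (block v) | mem S u v
  ...   | true  | true  = refl
  ...   | true  | false = refl
  ...   | false | true  = refl
  ...   | false | false = refl

  120≤size : 120 ≤ size S
  120≤size = begin
    120                                               ≡⟨ minCost-blocks ⟨
    minCost 0 [] blocks                               ≤⟨ minCost≤pairSum blocks ⟩
    pairSum edit (concat (map members blocks))        ≡⟨ cong (pairSum edit) concat-members ⟩
    pairSum edit (allFin 31)                          ≡⟨ pairSum-cong (allFin 31) ⟨
    pairSum (λ u v → indicator (mem S u v)) (allFin 31) ≡⟨ size≡pairSum S ⟨
    size S                                            ∎
    where
    open ≤-Reasoning
    pairSum-cong : ∀ vs → pairSum (λ u v → indicator (mem S u v)) vs ≡ pairSum edit vs
    pairSum-cong []       = refl
    pairSum-cong (u ∷ vs) = cong₂ _+_ (cong sum (map-cong (mem≡edit u) vs)) (pairSum-cong vs)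

-- Bad triangle transversals: the upper bound and positivity

softPairs-transversal : IsBadTriangleTransversal G softPairs
softPairs-transversal u v w (u≢w , e , f , ¬g)
  with soft-transversal (block u) (block v) (block w) (adjacent u v e) (adjacent v w f)
         (λ a → ¬g (subst T (sym (distinct u≢w)) a))
  where
  adjacent : ∀ u v → u ─ v ∈ G → T (adj (block u) (block v))
  adjacent u v e with no _ ← u ≟ v = e
  distinct : u ≢ w → mem G u w ≡ adj (block u) (block w)
  distinct u≢w rewrite dec-false (u ≟ w) u≢w = refl
... | inj₁ s = inj₁ s
... | inj₂ s = inj₂ (inj₁ s)

term≤∑ : ∀ {n} (f : Fin n → ℕ) i → f i ≤ ∑[ j < n ] f j
term≤∑ f zero    = ℕ.m≤m+n _ _
term≤∑ f (suc i) = ≤-trans (term≤∑ (f ∘ suc) i) (ℕ.m≤n+m _ _)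

<∧∈⇒0<size : ∀ {n} (S : PairSet n) {u v} → u Fin.< v → u ─ v ∈ S → 0 < size S
<∧∈⇒0<size {n} S {u} {v} u<v e = begin
  1                    ≡⟨ counted ⟨
  term u v             ≤⟨ term≤∑ (term u) v ⟩
  ∑[ w < n ] term u w  ≤⟨ term≤∑ (λ x → ∑[ w < n ] term x w) u ⟩
  size S               ∎
  where
  open ≤-Reasoning
  term : Fin n → Fin n → ℕ
  term u v = if does (u <? v) ∧ mem S u v then 1 else 0
  counted : term u v ≡ 1
  counted rewrite dec-true (u <? v) u<v with true ← mem S u v = refl

∈⇒0<size : ∀ {n} (S : PairSet n) {u v} → u ─ v ∈ S → 0 < size S
∈⇒0<size S {u} {v} e with <-cmp u v
... | tri< u<v _ _  = <∧∈⇒0<size S u<v e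
... | tri≈ _ refl _ = contradiction (subst T (irrefl S u) e) λ ()
... | tri> _ _ v<u  = <∧∈⇒0<size S v<u (subst T (symm S u v) e)

-- One bad triangle forces a pair into `S`; this makes the ratio of `G` defined.
0<transversal : ∀ S → IsBadTriangleTransversal G S → 0 < size S
0<transversal S transversal with transversal outer₀ inner₀ inner₁ ((λ ()) , _ , _ , λ ())
  where
  -- Vertices 0-3 form the centre, 4-15 the inner blocks in fours, and 16 starts the first outer
  -- block.
  inner₀ = # 4
  inner₁ = # 8
  outer₀ = # 16
... | inj₁ e        = ∈⇒0<size S e
... | inj₂ (inj₁ e) = ∈⇒0<size S e
... | inj₂ (inj₂ e) = ∈⇒0<size S e

-- The optima of `G` and their ratio

120≤ce : 120 ≤ ce G
120≤ce with ceOptimum G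
... | _ , (S , editing , refl) , _ = 120≤size S editing

btt≤108 : btt G ≤ 108
btt≤108 = proj₂ (proj₂ (bttOptimum G)) softPairs softPairs-transversal

0<btt : 0 < btt G
0<btt with bttOptimum G
... | _ , (S , transversal , refl) , _ = 0<transversal S transversal

-- `_/_` reduces to lowest terms, so the cross-multiplication takes place among unnormalised
-- fractions.
/-mono-≤ : ∀ m n p q .{{_ : NonZero n}} .{{_ : NonZero q}} →
           m * q ≤ p * n → + m / n ℚ.≤ + p / q
/-mono-≤ m (suc n) p (suc q) le = ℚ.toℚᵘ-cancel-≤ (begin
  ℚ.toℚᵘ (+ m / suc n)  ≃⟨ ℚ.toℚᵘ-fromℚᵘ (ℚᵘ.mkℚᵘ (+ m) n) ⟩
  ℚᵘ.mkℚᵘ (+ m) n       ≤⟨ ℚᵘ.*≤* (subst₂ ℤ._≤_ (ℤ.pos-* m (suc q)) (ℤ.pos-* p (suc n)) (ℤ.+≤+ le)) ⟩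
  ℚᵘ.mkℚᵘ (+ p) q       ≃⟨ ℚ.toℚᵘ-fromℚᵘ (ℚᵘ.mkℚᵘ (+ p) q) ⟨
  ℚ.toℚᵘ (+ p / suc q)  ∎)
  where open ℚᵘ.≤-Reasoning

10/9≤ratio : + 10 / 9 ℚ.≤ ratio (31 , G , 0<btt)
10/9≤ratio = /-mono-≤ 10 9 (ce G) (btt G) {{_}} {{>-nonZero 0<btt}} (begin
  10 * btt G  ≤⟨ ℕ.*-monoʳ-≤ 10 btt≤108 ⟩
  -- Both `10 * 108` and `120 * 9` are 1080.
  120 * 9     ≤⟨ ℕ.*-monoˡ-≤ 9 120≤ce ⟩
  ce G * 9    ∎)
  where open ≤-Reasoning

mainTheorem5 : (∃ λ (G : Graph 31) → ce G > btt G) × ρ ≥ᴿ fromℚ (+ 10 / 9)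
mainTheorem5 =
    (G , ≤-trans (s≤s btt≤108) (≤-trans (ℕ.m≤m+n 109 11) 120≤ce))
  -- The same graph witnesses membership in the cut of the supremum for every `q` below 10/9.
  , λ q<10/9 → (31 , G , 0<btt) , ℚ.<-≤-trans q<10/9 10/9≤ratio
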